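{- Let $G$ be a simple graph of order $n\ge 2$. Then: (i) $st_{\gamma_2}(G)\le n-1$; (ii) if $G$ has the star graph $K_{1,t}$ as an induced subgraph with $t\ge 3$, then $st_{\gamma_2}(G)\le n-t$.
   Context: All graphs are finite, simple and undirected. For a graph $G=(V,E)$, a subset $D \subseteq V$ is a 2-dominating set if every vertex $v \in V \setminus D$ has at least two neighbors in $D$. The 2-domination number $\gamma_2(G)$ is the minimum cardinality of a 2-dominating set of $G$. The stability of the 2-domination number, $st_{\gamma_2}(G)$, is the minimum number of vertices whose removal from $G$ (deleting the vertices and all incident edges) changes the 2-domination number, i.e. the minimum of $|S|$ over $S\subseteq V$ with $\gamma_2(G-S)\ne\gamma_2(G)$. -}

module Defs where

open import Data.Fin.Base using (Fin; zero; suc)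
open import Data.Fin.Properties using (any?; all?) renaming (_≟_ to _≟ᶠ_)
open import Data.Fin.Subset using (Subset; inside; outside; _∈_; _∉_; ⊤; ∁; ∣_∣; ⁅_⁆)
open import Data.Fin.Subset.Properties
  using (_∈?_; ∈⊤; ∣p∣≤n; ∣⁅x⁆∣≡1; ∣⊤∣≡n; ∣∁p∣≡n∸∣p∣; p⊆q⇒∣p∣≤∣q∣; x∈⁅y⁆⇒x≡y; anySubset?)
open import Data.Nat.Base using (ℕ; zero; suc; _∸_; _≤_; _<_)
open import Data.Nat.Induction using (Acc; acc; <-wellFounded)
open import Data.Nat.Properties using (_<?_; _≟_; ≮⇒≥; ≤-trans; ≤-reflexive; n∸n≡0)
open import Data.Product using (∃; ∃₂; _×_; _,_; proj₁; proj₂)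
open import Data.Vec.Base using (_∷_)
open import Function.Bundles using (_⇔_)
open import Function.Definitions using (Injective)
open import Level using (0ℓ)
open import Relation.Binary using (Rel; Symmetric; Decidable)
open import Relation.Binary.PropositionalEquality
  using (_≡_; _≢_; refl; sym; trans; cong; subst)
open import Relation.Nullary using (¬_; yes; no; ¬?; contradiction)
open import Relation.Nullary.Decidable using (_×-dec_; _→-dec_)
import Relation.Unary as U

-- A finite simple undirected graph of order n. Decidability of adjacency is
-- the constructive counterpart of the edge set being a subset of the finite
-- set of all pairs of vertices.
record Graph (n : ℕ) : Set₁ where
  infix 4 _~_ _~?_
  field
    _~_    : Rel (Fin n) 0ℓ
    _~?_   : Decidable _~_
    ~-sym  : Symmetric _~_
    ~-irr  : ∀ {v} → ¬ (v ~ v)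

-- The order-preserving enumeration of the elements of p.
enum : ∀ {n} (p : Subset n) → Fin ∣ p ∣ → Fin n
enum (inside  ∷ p) zero    = zero
enum (inside  ∷ p) (suc i) = suc (enum p i)
enum (outside ∷ p) i       = suc (enum p i)

-- The vertices of G ⊖ S are those outside S, renumbered along enum (∁ S).
infixl 6 _⊖_
_⊖_ : ∀ {n} → Graph n → (S : Subset n) → Graph ∣ ∁ S ∣
G ⊖ S = record
  { _~_   = λ i j → enum (∁ S) i ~ enum (∁ S) j
  ; _~?_  = λ i j → enum (∁ S) i ~? enum (∁ S) j
  ; ~-sym = ~-sym
  ; ~-irr = ~-irr
  }
  where open Graph G

-- k is the minimum cardinality of a subset satisfying P.
IsMinCard : ∀ {n} → U.Pred (Subset n) 0ℓ → ℕ → Set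
IsMinCard P k = (∃ λ p → P p × ∣ p ∣ ≡ k) × (∀ p → P p → k ≤ ∣ p ∣)

minCard : ∀ {n} {P : U.Pred (Subset n) 0ℓ} → U.Decidable P → ∃ P → ∃ (IsMinCard P)
minCard {P = P} P? (p , Pp) = go p Pp (<-wellFounded ∣ p ∣)
  where
  go : ∀ p → P p → Acc _<_ ∣ p ∣ → ∃ (IsMinCard P)
  go p Pp (acc rs) with anySubset? (λ q → P? q ×-dec (∣ q ∣ <? ∣ p ∣))
  ... | yes (q , Pq , q<p) = go q Pq (rs q<p)
  ... | no  ∄q             =
    ∣ p ∣ , (p , Pp , refl) , λ q Pq → ≮⇒≥ λ q<p → ∄q (q , Pq , q<p)

TwoDominating : ∀ {n} → Graph n → Subset n → Set
TwoDominating G D =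
  ∀ v → v ∉ D → ∃₂ λ x y → x ≢ y × (x ∈ D × v ~ x) × (y ∈ D × v ~ y)
  where open Graph G

twoDominating? : ∀ {n} (G : Graph n) → U.Decidable (TwoDominating G)
twoDominating? G D =
  all? λ v → ¬? (v ∈? D) →-dec any? λ x → any? λ y →
    ¬? (x ≟ᶠ y) ×-dec ((x ∈? D) ×-dec (v ~? x)) ×-dec ((y ∈? D) ×-dec (v ~? y))
  where open Graph G

γ₂-exists : ∀ {n} (G : Graph n) → ∃ (IsMinCard (TwoDominating G))
γ₂-exists G = minCard (twoDominating? G) (⊤ , λ v v∉⊤ → contradiction ∈⊤ v∉⊤)

γ₂ : ∀ {n} → Graph n → ℕ
γ₂ G = proj₁ (γ₂-exists G)

ChangesNumber : ∀ {n} → Graph n → Subset n → Set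
ChangesNumber G S = γ₂ (G ⊖ S) ≢ γ₂ G

changesNumber? : ∀ {n} (G : Graph n) → U.Decidable (ChangesNumber G)
changesNumber? G S = ¬? (γ₂ (G ⊖ S) ≟ γ₂ G)

γ₂≤n : ∀ {n} (G : Graph n) → γ₂ G ≤ n
γ₂≤n G with γ₂-exists G
... | k , (p , _ , ∣p∣≡k) , _ = ≤-trans (≤-reflexive (sym ∣p∣≡k)) (∣p∣≤n p)

0<γ₂ : ∀ {n} (G : Graph n) → 1 ≤ n → 1 ≤ γ₂ G
0<γ₂ {suc n} G _ with γ₂-exists G
... | k , (D , dom , ∣D∣≡k) , _ = subst (1 ≤_) ∣D∣≡k 1≤∣D∣
  where
  ∈⇒ : ∀ {x} → x ∈ D → 1 ≤ ∣ D ∣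
  ∈⇒ {x} x∈D = subst (_≤ ∣ D ∣) (∣⁅x⁆∣≡1 x)
    (p⊆q⇒∣p∣≤∣q∣ λ y∈ → subst (_∈ D) (sym (x∈⁅y⁆⇒x≡y x y∈)) x∈D)

  1≤∣D∣ : 1 ≤ ∣ D ∣
  1≤∣D∣ with zero ∈? D
  ... | yes 0∈D = ∈⇒ 0∈D
  ... | no  0∉D with dom zero 0∉D
  ...   | _ , _ , _ , (x∈D , _) , _ = ∈⇒ x∈D

-- Removing every vertex of a nonempty graph brings γ₂ down to 0, so the
-- stability is well defined exactly for graphs of positive order.
removeAll : ∀ {n} (G : Graph n) → 1 ≤ n → ChangesNumber G ⊤
removeAll {n} G 1≤n eq = contradiction 1≤0 λ ()
  where
  ∣∁⊤∣≡0 : ∣ ∁ (⊤ {n}) ∣ ≡ 0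
  ∣∁⊤∣≡0 = trans (∣∁p∣≡n∸∣p∣ (⊤ {n})) (trans (cong (n ∸_) (∣⊤∣≡n n)) (n∸n≡0 n))

  1≤0 : 1 ≤ 0
  1≤0 = ≤-trans (0<γ₂ G 1≤n)
    (≤-trans (≤-reflexive (sym eq)) (subst (γ₂ (G ⊖ ⊤) ≤_) ∣∁⊤∣≡0 (γ₂≤n (G ⊖ ⊤))))

st-exists : ∀ {n} (G : Graph n) → 1 ≤ n → ∃ (IsMinCard (ChangesNumber G))
st-exists G 1≤n = minCard (changesNumber? G) (⊤ , removeAll G 1≤n)

st-γ₂ : ∀ {n} → Graph n → 1 ≤ n → ℕ
st-γ₂ G 1≤n = proj₁ (st-exists G 1≤n)

-- Adjacency in K₁,ₜ: vertex zero is the centre and the vertices suc i are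
-- the leaves.
data StarAdj {t : ℕ} : Rel (Fin (suc t)) 0ℓ where
  centre-leaf : ∀ i → StarAdj zero (suc i)
  leaf-centre : ∀ i → StarAdj (suc i) zero

star : (t : ℕ) → Graph (suc t)
star t = record
  { _~_   = StarAdj
  ; _~?_  = dec
  ; ~-sym = λ { (centre-leaf i) → leaf-centre i ; (leaf-centre i) → centre-leaf i }
  ; ~-irr = λ ()
  }
  where
  dec : Decidable StarAdj
  dec zero    zero    = no λ ()
  dec zero    (suc j) = yes (centre-leaf j)
  dec (suc i) zero    = yes (leaf-centre i)
  dec (suc i) (suc j) = no λ ()

-- H is isomorphic to the subgraph of G induced by some set of vertices,
-- namely the image of f.
_InducedSubgraphOf_ : ∀ {m n} → Graph m → Graph n → Set
_InducedSubgraphOf_ {m} {n} H G =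
  ∃ λ (f : Fin m → Fin n) →
    Injective _≡_ _≡_ f × (∀ u v → (u H.~ v) ⇔ (f u G.~ f v))
  where
  module H = Graph H
  module G = Graph G

{-# OPTIONS --safe #-}
-- A vertex set of size n ∸ m whose removal leaves a graph with γ₂ different from
-- γ₂ G bounds the stability. Keeping a single vertex gives γ₂ ≤ 1 < 2 ≤ γ₂ G. If
-- K₁,ₜ is induced, then keeping its t leaves gives γ₂ = t (there are no edges),
-- whereas keeping the centre and t ∸ 1 ≥ 2 leaves gives γ₂ < t (the centre can be
-- left out of the dominating set); these two numbers cannot both be γ₂ G.
module Submission where

open import Defs
open import Data.Fin.Base using (Fin; zero; suc; inject₁)
open import Data.Fin.Properties using (injective⇒≤; inject₁-injective; suc-injective)
  renaming (_≟_ to _≟ᶠ_)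
open import Data.Fin.Subset
  using (Subset; inside; outside; _∈_; _∪_; _-_; ⊤; ⊥; ∁; ∣_∣; ⁅_⁆)
open import Data.Fin.Subset.Properties
  using ( _∈?_; ∈⊤; ∉⊥; ∣p∣≤n; ∣⊤∣≡n; ∣∁p∣≡n∸∣p∣; p⊆q⇒∣p∣≤∣q∣; x∈⁅x⁆; x∈⁅y⁆⇒x≡y
        ; x∈p∪q⁺; x∈p∪q⁻; x∉∁p⇒x∈p; x∈∁p⇒x∉p; x∈p⇒x∉∁p; x∉p⇒x∈∁p
        ; x∈p∧x≢y⇒x∈p-y; x∈p⇒∣p-x∣<∣p∣)
open import Data.Nat.Base using (ℕ; zero; suc; _∸_; _≤_; _<_; s≤s; z≤n)
open import Data.Nat.Properties
  using ( _≟_; <⇒≤; <⇒≢; ≤-trans; ≤-antisym; ≤-<-trans; <-≤-trans; ≤-reflexive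
        ; m∸[m∸n]≡n)
open import Data.Product using (∃; _×_; _,_; proj₁; proj₂)
open import Data.Sum.Base using (inj₁; inj₂)
open import Data.Vec.Base using (_∷_; here; there)
open import Function.Base using (_∘_)
open import Function.Bundles using (Equivalence)
open import Function.Definitions using (Injective)
open import Relation.Binary.PropositionalEquality
  using (_≡_; _≢_; refl; sym; trans; cong; subst; subst₂; module ≡-Reasoning)
open import Relation.Nullary using (Dec; ¬_; yes; no; contradiction)

private
  variable
    m n : ℕ

enum-∈ : (p : Subset n) (i : Fin ∣ p ∣) → enum p i ∈ p
enum-∈ (inside  ∷ p) zero    = here
enum-∈ (inside  ∷ p) (suc i) = there (enum-∈ p i)
enum-∈ (outside ∷ p) i       = there (enum-∈ p i)

enum-injective : (p : Subset n) → Injective _≡_ _≡_ (enum p)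
enum-injective (inside  ∷ p) {zero}  {zero}  eq = refl
enum-injective (inside  ∷ p) {suc i} {suc j} eq =
  cong suc (enum-injective p (suc-injective eq))
enum-injective (outside ∷ p) eq = enum-injective p (suc-injective eq)

enum-surjective : {p : Subset n} {x : Fin n} → x ∈ p → ∃ λ i → enum p i ≡ x
enum-surjective {p = inside  ∷ p} here        = zero , refl
enum-surjective {p = inside  ∷ p} (there x∈p) with i , refl ← enum-surjective x∈p = suc i , refl
enum-surjective {p = outside ∷ p} (there x∈p) with i , refl ← enum-surjective x∈p = i , refl

range : (Fin m → Fin n) → Subset n
range {m = zero}  g = ⊥
range {m = suc m} g = ⁅ g zero ⁆ ∪ range (g ∘ suc)

∈-range⁺ : (g : Fin m → Fin n) (j : Fin m) → g j ∈ range g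
∈-range⁺ g zero    = x∈p∪q⁺ (inj₁ (x∈⁅x⁆ (g zero)))
∈-range⁺ g (suc j) = x∈p∪q⁺ (inj₂ (∈-range⁺ (g ∘ suc) j))

∈-range⁻ : (g : Fin m → Fin n) {x : Fin n} → x ∈ range g → ∃ λ j → x ≡ g j
∈-range⁻ {m = zero}  g x∈ = contradiction x∈ ∉⊥
∈-range⁻ {m = suc m} g x∈ with x∈p∪q⁻ ⁅ g zero ⁆ (range (g ∘ suc)) x∈
... | inj₁ x∈⁅⁆ = zero , x∈⁅y⁆⇒x≡y (g zero) x∈⁅⁆
... | inj₂ x∈r  with j , x≡ ← ∈-range⁻ (g ∘ suc) x∈r = suc j , x≡

-- A set to be kept is given by an injection `g`, so that the vertices of the remaining graph,
-- numbered by `enum`, can be traded for indices of `g` in both directions. The double complement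
-- `∁ removed` arises because `G ⊖ removed` enumerates `∁ removed`.
module Keep (g : Fin m → Fin n) (g-injective : Injective _≡_ _≡_ g) where

  removed : Subset n
  removed = ∁ (range g)

  kept⇒range : (i : Fin ∣ ∁ removed ∣) → ∃ λ j → enum (∁ removed) i ≡ g j
  kept⇒range i = ∈-range⁻ g (x∉∁p⇒x∈p (x∈∁p⇒x∉p (enum-∈ (∁ removed) i)))

  range⇒kept : (j : Fin m) → ∃ λ i → enum (∁ removed) i ≡ g j
  range⇒kept j = enum-surjective (x∉p⇒x∈∁p (x∈p⇒x∉∁p (∈-range⁺ g j)))

  ∣kept∣≡m : ∣ ∁ removed ∣ ≡ m
  ∣kept∣≡m = ≤-antisym
    -- Each of the two index translations is injective, because `enum` and `g` are; this gives one
    -- inequality each.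
    (injective⇒≤ λ {i} {i′} eq → enum-injective (∁ removed)
      (trans (proj₂ (kept⇒range i)) (trans (cong g eq) (sym (proj₂ (kept⇒range i′))))))
    (injective⇒≤ λ {j} {j′} eq → g-injective
      (trans (sym (proj₂ (range⇒kept j)))
        (trans (cong (enum (∁ removed)) eq) (proj₂ (range⇒kept j′)))))

  ∣removed∣≡n∸m : ∣ removed ∣ ≡ n ∸ m
  ∣removed∣≡n∸m = begin
    ∣ removed ∣            ≡⟨ m∸[m∸n]≡n (∣p∣≤n removed) ⟨
    n ∸ (n ∸ ∣ removed ∣)  ≡⟨ cong (n ∸_) (∣∁p∣≡n∸∣p∣ removed) ⟨
    n ∸ ∣ ∁ removed ∣      ≡⟨ cong (n ∸_) ∣kept∣≡m ⟩
    n ∸ m                  ∎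
    where open ≡-Reasoning

γ₂≤∣D∣ : (G : Graph n) {D : Subset n} → TwoDominating G D → γ₂ G ≤ ∣ D ∣
γ₂≤∣D∣ G = proj₂ (proj₂ (γ₂-exists G)) _

≤γ₂ : (G : Graph n) {k : ℕ} → (∀ D → TwoDominating G D → k ≤ ∣ D ∣) → k ≤ γ₂ G
≤γ₂ G bound with D , dom , ∣D∣≡γ₂ ← proj₁ (proj₂ (γ₂-exists G)) =
  subst (_ ≤_) ∣D∣≡γ₂ (bound D dom)

st-γ₂≤∣S∣ : (G : Graph n) (1≤n : 1 ≤ n) (S : Subset n) →
            ChangesNumber G S → st-γ₂ G 1≤n ≤ ∣ S ∣
st-γ₂≤∣S∣ G 1≤n = proj₂ (proj₂ (st-exists G 1≤n))

-- A vertex outside a 2-dominating set has a neighbour, so without edges only the full vertex set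
-- qualifies.
γ₂-edgeless : (G : Graph n) → (∀ x y → ¬ Graph._~_ G x y) → γ₂ G ≡ n
γ₂-edgeless {n} G edgeless = ≤-antisym (γ₂≤n G) (≤γ₂ G n≤∣D∣)
  where
  n≤∣D∣ : ∀ D → TwoDominating G D → n ≤ ∣ D ∣
  n≤∣D∣ D dom = subst (_≤ ∣ D ∣) (∣⊤∣≡n n) (p⊆q⇒∣p∣≤∣q∣ {p = ⊤} λ {v} _ → all∈D v)
    where
    all∈D : ∀ v → v ∈ D
    all∈D v with v ∈? D
    ... | yes v∈D = v∈D
    ... | no  v∉D with x , _ , _ , (_ , v~x) , _ ← dom v v∉D =
      contradiction v~x (edgeless v x)

-- Every vertex except `c` forms a 2-dominating set: `x` and `y` differ from `c` by irreflexivity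
-- and dominate it.
γ₂<n : (G : Graph n) (let open Graph G) {c x y : Fin n} →
       x ≢ y → c ~ x → c ~ y → γ₂ G < n
γ₂<n {n} G {c} {x} {y} x≢y c~x c~y =
  ≤-<-trans (γ₂≤∣D∣ G dom) (subst (∣ ⊤ - c ∣ <_) (∣⊤∣≡n n) (x∈p⇒∣p-x∣<∣p∣ {x = c} {p = ⊤} ∈⊤))
  where
  open Graph G

  neighbour∈ : ∀ {z} → c ~ z → z ∈ ⊤ - c
  neighbour∈ c~z = x∈p∧x≢y⇒x∈p-y ∈⊤ λ { refl → ~-irr c~z }

  dom : TwoDominating G (⊤ - c)
  dom v v∉ with v ≟ᶠ c
  ... | yes refl = x , y , x≢y , (neighbour∈ c~x , c~x) , (neighbour∈ c~y , c~y)
  ... | no  v≢c  = contradiction (x∈p∧x≢y⇒x∈p-y ∈⊤ v≢c) v∉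

2≤∣p∣ : {p : Subset n} {x y : Fin n} → x ≢ y → x ∈ p → y ∈ p → 2 ≤ ∣ p ∣
2≤∣p∣ {p = p} x≢y x∈p y∈p =
  -- Deleting `x` from `p` shrinks it strictly, and so does then deleting `y`, which is still
  -- present.
  <-≤-trans (s≤s (≤-<-trans z≤n (x∈p⇒∣p-x∣<∣p∣ (x∈p∧x≢y⇒x∈p-y y∈p (x≢y ∘ sym)))))
    (x∈p⇒∣p-x∣<∣p∣ x∈p)

-- Either the vertices 0 and 1 both lie in `D`, or one of them is missing and its two dominating
-- neighbours do.
2≤γ₂ : (G : Graph n) → 2 ≤ n → 2 ≤ γ₂ G
2≤γ₂ G (s≤s (s≤s _)) = ≤γ₂ G 2≤∣D∣
  where
  2≤∣D∣ : ∀ D → TwoDominating G D → 2 ≤ ∣ D ∣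
  2≤∣D∣ D dom with zero ∈? D | suc zero ∈? D
  ... | yes 0∈D | yes 1∈D = 2≤∣p∣ (λ ()) 0∈D 1∈D
  ... | no  0∉D | _       with _ , _ , x≢y , (x∈D , _) , (y∈D , _) ← dom _ 0∉D = 2≤∣p∣ x≢y x∈D y∈D
  ... | yes _   | no  1∉D with _ , _ , x≢y , (x∈D , _) , (y∈D , _) ← dom _ 1∉D = 2≤∣p∣ x≢y x∈D y∈D

st-γ₂≤n∸1 : (2≤n : 2 ≤ n) (G : Graph n) → st-γ₂ G (<⇒≤ 2≤n) ≤ n ∸ 1
st-γ₂≤n∸1 {n@(suc _)} 2≤n G =
  subst (st-γ₂ G (<⇒≤ 2≤n) ≤_) ∣removed∣≡n∸m
    (st-γ₂≤∣S∣ G (<⇒≤ 2≤n) removed (<⇒≢ γ₂<))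
  where
  vertex : Fin 1 → Fin n
  vertex _ = zero

  vertex-injective : Injective _≡_ _≡_ vertex
  vertex-injective {zero} {zero} _ = refl

  open Keep vertex vertex-injective

  γ₂< : γ₂ (G ⊖ removed) < γ₂ G
  -- The remaining graph has order 1, which bounds its 2-domination number.
  γ₂< = <-≤-trans (s≤s (≤-trans (γ₂≤n (G ⊖ removed)) (≤-reflexive ∣kept∣≡m))) (2≤γ₂ G 2≤n)

st-γ₂≤n∸t : (1≤n : 1 ≤ n) (G : Graph n) (t : ℕ) → 3 ≤ t →
            star t InducedSubgraphOf G → st-γ₂ G 1≤n ≤ n ∸ t
st-γ₂≤n∸t {n} 1≤n G t@(suc (suc (suc _))) (s≤s (s≤s (s≤s _))) (f , f-injective , f-induced) =
  conclude (γ₂ (G ⊖ Leaves.removed) ≟ γ₂ G)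
  where
  open Graph G
  module Leaves  = Keep (f ∘ suc) (suc-injective ∘ f-injective)
  -- `inject₁` omits only the last leaf, so the centre and `t ∸ 1` leaves are kept: again `t`
  -- vertices.
  module Smaller = Keep (f ∘ inject₁) (inject₁-injective ∘ f-injective)
  open Smaller using (range⇒kept)

  γ₂-leaves : γ₂ (G ⊖ Leaves.removed) ≡ t
  γ₂-leaves = trans (γ₂-edgeless (G ⊖ Leaves.removed) edgeless) Leaves.∣kept∣≡m
    where
    edgeless : ∀ x y → ¬ Graph._~_ (G ⊖ Leaves.removed) x y
    edgeless x y x~y
      -- Both vertices are images of leaves, and `StarAdj` joins no two leaves.
      with i , x≡ ← Leaves.kept⇒range x | j , y≡ ← Leaves.kept⇒range y
      with () ← Equivalence.from (f-induced (suc i) (suc j)) (subst₂ _~_ x≡ y≡ x~y)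

  γ₂-smaller : γ₂ (G ⊖ Smaller.removed) < t
  γ₂-smaller = subst (γ₂ (G ⊖ Smaller.removed) <_) Smaller.∣kept∣≡m
    (γ₂<n (G ⊖ Smaller.removed) x≢y (centre~ zero) (centre~ (suc zero)))
    where
    kept : Fin t → Fin ∣ ∁ Smaller.removed ∣
    kept j = proj₁ (range⇒kept j)

    centre~ : ∀ i → Graph._~_ (G ⊖ Smaller.removed) (kept zero) (kept (suc i))
    centre~ i = subst₂ _~_ (sym (proj₂ (range⇒kept zero))) (sym (proj₂ (range⇒kept (suc i))))
      -- `inject₁ (suc i)` reduces to `suc (inject₁ i)`, so `kept (suc i)` stands for a leaf.
      (Equivalence.to (f-induced _ _) (centre-leaf (inject₁ i)))

    x≢y : kept (suc zero) ≢ kept (suc (suc zero))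
    x≢y eq with () ← inject₁-injective (f-injective
      (trans (sym (proj₂ (range⇒kept (suc zero))))
        (trans (cong (enum (∁ Smaller.removed)) eq) (proj₂ (range⇒kept (suc (suc zero)))))))

  conclude : Dec (γ₂ (G ⊖ Leaves.removed) ≡ γ₂ G) → st-γ₂ G 1≤n ≤ n ∸ t
  conclude (no  changes) = subst (st-γ₂ G 1≤n ≤_) Leaves.∣removed∣≡n∸m
    (st-γ₂≤∣S∣ G 1≤n Leaves.removed changes)
  -- Now `γ₂ G` equals `t`, which exceeds the number for `Smaller`; as many vertices are removed as
  -- before.
  conclude (yes same)    = subst (st-γ₂ G 1≤n ≤_) Smaller.∣removed∣≡n∸m
    (st-γ₂≤∣S∣ G 1≤n Smaller.removed
      (<⇒≢ (subst (γ₂ (G ⊖ Smaller.removed) <_) (trans (sym γ₂-leaves) same) γ₂-smaller)))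

theorem3p2 : ∀ (n : ℕ) (2≤n : 2 ≤ n) (G : Graph n) →
    (st-γ₂ G (<⇒≤ 2≤n) ≤ n ∸ 1)
    × (∀ (t : ℕ) → 3 ≤ t → star t InducedSubgraphOf G → st-γ₂ G (<⇒≤ 2≤n) ≤ n ∸ t)
theorem3p2 n 2≤n G = st-γ₂≤n∸1 2≤n G , st-γ₂≤n∸t (<⇒≤ 2≤n) G
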